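{- Let $X\neq\emptyset$ be a set, $v:At\to\mathcal{P}(X)$ a valuation, $\mathcal{D}=(X,v)$, and let $\mathfrak{r}:At\to\mathcal{P}(X)$ be a function with $\mathfrak{r}(p)\subseteq v(p)$ for every $p\in At$. Then the class $\mathbb{M}^{\mathcal{D},\mathfrak{r}}$ has a smallest model with respect to $\leq$; that is, there exists $\mathcal{M}=(X,\mathcal{T},v)\in\mathbb{M}^{\mathcal{D},\mathfrak{r}}$ such that $\mathcal{M}\leq\mathcal{M}'$ for every $\mathcal{M}'\in\mathbb{M}^{\mathcal{D},\mathfrak{r}}$.
   Context: Let $At$ be a countable set of atoms. A model is $\mathcal{M}=(X,\mathcal{T},v)$ where $X\neq\emptyset$ is a set, $\mathcal{T}$ is a topology on $X$, and $v:At\to\mathcal{P}(X)$. A propositional formula is one built from atoms using $\neg$ and $\wedge$ only. For propositional $\varphi$, $\mathcal{M},s\models\varphi$ is defined classically with $\mathcal{M},s\models p$ iff $s\in v(p)$, and $||\varphi||^{\mathcal{M}}=\{s\in X:\mathcal{M},s\models\varphi\}$. Moreover $\mathcal{M},s\models\mathcal{R}(\varphi)$ iff $s\in\mathrm{int}(||\varphi||^{\mathcal{M}})$, where $\mathrm{int}(A)=\bigcup\{O\in\mathcal{T}:O\subseteq A\}$. Given $\mathcal{D}=(X,v)$ and $\mathfrak{r}:At\to\mathcal{P}(X)$ with $\mathfrak{r}(p)\subseteq v(p)$ for all $p$, $\mathbb{M}^{\mathcal{D},\mathfrak{r}}$ is the class of all models $(X,\mathcal{T},v)$ (same $X$ and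 $v$) such that $\mathfrak{r}(p)\in\mathcal{T}$ for every $p\in At$. For models $\mathcal{M}_1=(X,\mathcal{T}_1,v)$ and $\mathcal{M}_2=(X,\mathcal{T}_2,v)$, write $\mathcal{M}_1\leq\mathcal{M}_2$ iff for every propositional formula $\varphi$ and every $s\in X$, $\mathcal{M}_1,s\models\mathcal{R}(\varphi)$ implies $\mathcal{M}_2,s\models\mathcal{R}(\varphi)$. -}

module Defs where

open import Data.Product.Base using (Σ-syntax; _×_; proj₁)
open import Level using (Level; suc)
open import Relation.Nullary.Negation.Core using (¬_)
open import Relation.Unary using (Pred; _∈_; _⊆_; _≐_; _∩_; ⋃)
open import Relation.Unary.Polymorphic using (∅; U)

private
  variable
    ℓ : Level

-- 𝒫(X) is Pred X ℓ, taken up to extensional equality _≐_.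
--
-- An arbitrary family of opens is indexed by a type of level suc ℓ, so that
-- {O ∈ 𝒯 : O ⊆ A} is an admissible family.  Its union then lives in
-- Pred X (suc ℓ), hence ⋃-open speaks of a subset V extensionally equal to
-- that union.  For a one-member family this says that opens respect _≐_.

record Topology (X : Set ℓ) : Set (suc (suc ℓ)) where
  field
    Open   : Pred (Pred X ℓ) (suc ℓ)
    ∅-open : ∅ ∈ Open
    U-open : U ∈ Open
    ∩-open : ∀ {O P} → O ∈ Open → P ∈ Open → O ∩ P ∈ Open
    ⋃-open : ∀ {I : Set (suc ℓ)} (O : I → Pred X ℓ) →
             (∀ i → O i ∈ Open) →
             ∀ {V : Pred X ℓ} → V ≐ ⋃ I O → V ∈ Open

  int : Pred X ℓ → Pred X (suc ℓ)
  int A = ⋃ (Σ[ O ∈ Pred X ℓ ] (O ∈ Open × O ⊆ A)) proj₁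

data Formula (At : Set ℓ) : Set ℓ where
  atom : At → Formula At
  ¬ᶠ_  : Formula At → Formula At
  _∧ᶠ_ : Formula At → Formula At → Formula At

-- The pair 𝒟 = (X , v), with X ≠ ∅.

record Domain (At : Set ℓ) : Set (suc ℓ) where
  field
    X   : Set ℓ
    X≠∅ : ¬ ¬ X
    v   : At → Pred X ℓ

-- A model (X , 𝒯 , v) whose X and v are those of 𝒟.

record Model {At : Set ℓ} (𝒟 : Domain At) : Set (suc (suc ℓ)) where
  open Domain 𝒟 public
  field
    𝒯 : Topology X
  open Topology 𝒯 public

module _ {At : Set ℓ} {𝒟 : Domain At} where

  open Domain 𝒟 using (X)

  infix 4 _,_⊨_ _,_⊨ℛ_ _≤_

  _,_⊨_ : Model 𝒟 → X → Formula At → Set ℓ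
  M , s ⊨ atom p   = s ∈ Model.v M p
  M , s ⊨ (¬ᶠ φ)   = ¬ (M , s ⊨ φ)
  M , s ⊨ (φ ∧ᶠ ψ) = (M , s ⊨ φ) × (M , s ⊨ ψ)

  ‖_‖ : Formula At → Model 𝒟 → Pred X ℓ
  ‖ φ ‖ M = λ s → M , s ⊨ φ

  _,_⊨ℛ_ : Model 𝒟 → X → Formula At → Set (suc ℓ)
  M , s ⊨ℛ φ = s ∈ Model.int M (‖ φ ‖ M)

  _≤_ : Model 𝒟 → Model 𝒟 → Set (suc ℓ)
  M₁ ≤ M₂ = ∀ φ s → M₁ , s ⊨ℛ φ → M₂ , s ⊨ℛ φ

𝕄 : {At : Set ℓ} (𝒟 : Domain At) → (At → Pred (Domain.X 𝒟) ℓ) →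
    Pred (Model 𝒟) (suc ℓ)
𝕄 𝒟 𝔯 M = ∀ p → 𝔯 p ∈ Model.Open M

{-# OPTIONS --safe #-}
module Submission where

-- The smallest model carries the topology generated by the subbasis
-- {𝔯 p : p ∈ At}.  It is contained in every topology in which all 𝔯 p are open,
-- the interior operator is monotone in the topology, and the truth sets ‖ φ ‖
-- do not depend on the topology.

open import Defs
open import Data.List.Base using (List; []; _∷_; _++_; [_]; foldr)
open import Data.Nat.Base using (ℕ)
open import Data.Product.Base using (Σ-syntax; _×_; _,_; proj₁; proj₂)
open import Data.Unit.Polymorphic.Base using (tt)
open import Function.Base using (_∘_)
open import Function.Bundles using (_↣_)
open import Level using (Level; Lift; lift; lower; suc)
open import Relation.Unary using (Pred; _∈_; _⊆_; _∩_)
open import Relation.Unary.Polymorphic using (U)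

private
  variable
    ℓ : Level

module _ {X A : Set ℓ} (S : A → Pred X ℓ) where

  ⋂ : List A → Pred X ℓ
  ⋂ = foldr (λ a → S a ∩_) U

  -- With `⋂-++⁻`, this closes the basic sets under binary intersection, as `∩-open` of `generated`
  -- requires.
  ⋂-++⁺ : ∀ as {bs} → ⋂ as ∩ ⋂ bs ⊆ ⋂ (as ++ bs)
  ⋂-++⁺ []       (_ , y)       = y
  ⋂-++⁺ (_ ∷ as) ((s , x) , y) = s , ⋂-++⁺ as (x , y)

  ⋂-++⁻ : ∀ as {bs} → ⋂ (as ++ bs) ⊆ ⋂ as ∩ ⋂ bs
  ⋂-++⁻ []       y       = tt , y
  ⋂-++⁻ (_ ∷ as) (s , z) =
    let x , y = ⋂-++⁻ as z in (s , x) , y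

  -- Openness in `generated` is stated pointwise through these neighbourhoods, so that no family of
  -- basic sets has to be carried along with an open set.
  BasicNbhd : Pred X ℓ → Pred X ℓ
  BasicNbhd V x = Σ[ as ∈ List A ] (x ∈ ⋂ as × ⋂ as ⊆ V)

  generated : Topology X
  generated = record
    { Open   = λ V → Lift (suc ℓ) (V ⊆ BasicNbhd V)
    ; ∅-open = lift λ ()
    ; U-open = lift λ _ → [] , tt , λ _ → tt
    ; ∩-open = λ (lift o) (lift p) → lift λ (x∈O , x∈P) →
        let as , x∈as , as⊆O = o x∈O
            bs , x∈bs , bs⊆P = p x∈P
        in as ++ bs , ⋂-++⁺ as (x∈as , x∈bs) ,
           λ z → let z∈as , z∈bs = ⋂-++⁻ as z in as⊆O z∈as , bs⊆P z∈bs
    ; ⋃-open = λ O O-open (V⊆⋃ , ⋃⊆V) → lift λ x∈V →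
        let i , x∈Oi          = V⊆⋃ x∈V
            as , x∈as , as⊆Oi = lower (O-open i) x∈Oi
        in as , x∈as , λ z → ⋃⊆V (i , as⊆Oi z)
    }

  subbasis-open : ∀ a → S a ∈ Topology.Open generated
  subbasis-open a = lift λ x∈Sa → [ a ] , (x∈Sa , tt) , proj₁

  module _ (𝒯 : Topology X) (S-open : ∀ a → S a ∈ Topology.Open 𝒯) where
    open Topology 𝒯

    ⋂-open : ∀ as → ⋂ as ∈ Open
    ⋂-open []       = U-open
    ⋂-open (a ∷ as) = ∩-open (S-open a) (⋂-open as)

    generated-least : Topology.Open generated ⊆ Open
    generated-least {V} (lift V⊆nbhd) =
      -- `V` is the union of all basic sets inside it. `Lift` raises the index type to the level at
      -- which `⋃-open` takes families.
      ⋃-open {I = Lift (suc ℓ) (Σ[ as ∈ List A ] ⋂ as ⊆ V)}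
        (⋂ ∘ proj₁ ∘ lower) (⋂-open ∘ proj₁ ∘ lower)
        ( (λ x∈V → let as , x∈as , as⊆V = V⊆nbhd x∈V in lift (as , as⊆V) , x∈as)
        , λ (lift (_ , as⊆V) , x∈as) → as⊆V x∈as )

module _ {At : Set ℓ} {𝒟 : Domain At} where

  ‖‖-invariant : ∀ (M M′ : Model 𝒟) φ → ‖ φ ‖ M ⊆ ‖ φ ‖ M′
  ‖‖-invariant M M′ (atom p) s⊨p         = s⊨p
  -- Negation reverses inclusion, so the induction hypothesis is taken with the models exchanged.
  ‖‖-invariant M M′ (¬ᶠ φ)   s⊭φ         = s⊭φ ∘ ‖‖-invariant M′ M φ
  ‖‖-invariant M M′ (φ ∧ᶠ ψ) (s⊨φ , s⊨ψ) =
    ‖‖-invariant M M′ φ s⊨φ , ‖‖-invariant M M′ ψ s⊨ψ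

  -- The open set `O` that witnesses membership in the interior for `M` serves unchanged for `M′`.
  coarser⇒≤ : ∀ (M M′ : Model 𝒟) → Model.Open M ⊆ Model.Open M′ → M ≤ M′
  coarser⇒≤ M M′ ⊆-open φ s ((O , O-open , O⊆φ) , s∈O) =
    (O , ⊆-open O-open , λ z → ‖‖-invariant M M′ φ (O⊆φ z)) , s∈O

theorem6p3 : ∀ {ℓ : Level} {At : Set ℓ} → At ↣ ℕ →
    (𝒟 : Domain At) (𝔯 : At → Pred (Domain.X 𝒟) ℓ) →
    (∀ p → 𝔯 p ⊆ Domain.v 𝒟 p) →
    Σ[ M ∈ Model 𝒟 ] (M ∈ 𝕄 𝒟 𝔯 × (∀ M′ → M′ ∈ 𝕄 𝒟 𝔯 → M ≤ M′))
theorem6p3 _ 𝒟 𝔯 _ =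
  M , subbasis-open 𝔯 ,
  λ M′ 𝔯-open → coarser⇒≤ M M′ (generated-least 𝔯 (Model.𝒯 M′) 𝔯-open)
  where
  M : Model 𝒟
  M = record { 𝒯 = generated 𝔯 }
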